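{- Let $d\ge 2$, let $\vec a=(a_1,\ldots,a_d)$ be a vector of relatively prime positive integers, and let $t\in\mathbb{Z}^d$ be such that $\mathcal{F}_{\vec a}(t)=1$. Then $-\mathcal{H}_{\vec a}=\mathcal{H}_{\vec a}+t$.
   Context: $e_1,\ldots,e_d$ is the standard basis of $\mathbb{Z}^d$ and $\mathbb{E}_d=\{(u,u+e_i): u\in\mathbb{Z}^d,\ 1\le i\le d\}$. "Relatively prime" means $\gcd(a_1,\ldots,a_d)=1$. Put $s=\sum_i a_i$ and let $\mathcal{F}_{\vec a}:\mathbb{Z}^d\to\mathbb{Z}/s\mathbb{Z}$, $(x_1,\ldots,x_d)\mapsto\sum_i a_ix_i\bmod s$, where $\mathbb{Z}/s\mathbb{Z}$ is identified with $\{0,1,\ldots,s-1\}$ with its usual total order. The Christoffel graph of normal vector $\vec a$ is $\mathcal{H}_{\vec a}=\{(u,u+e_i)\in\mathbb{E}_d:\mathcal{F}_{\vec a}(u)<\mathcal{F}_{\vec a}(u+e_i)\}$. For $X\subseteq\mathbb{E}_d$: the reversal is $-X=\{(-v,-u)\mid(u,v)\in X\}$ and the translate is $X+t=\{(u+t,v+t)\mid(u,v)\in X\}$. -}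

module Defs where

open import Data.Nat as ℕ using (ℕ; NonZero; >-nonZero)
import Data.Nat.Properties as ℕ
open import Data.Nat.GCD using (gcd)
open import Data.Integer as ℤ using (ℤ; +_; 0ℤ; 1ℤ)
open import Data.Integer.DivMod using (_%ℕ_; n%ℕd<d)
open import Data.Fin as Fin using (Fin; fromℕ<)
open import Data.Vec using (Vec; _∷_; sum; map; zipWith; replicate; foldr′; _[_]≔_)
open import Data.Vec.Relation.Unary.All using (All; _∷_)
open import Data.Product using (_×_; _,_; ∃-syntax)
open import Level using (0ℓ)
open import Relation.Binary.PropositionalEquality using (_≡_)
open import Relation.Unary using (Pred; _∈_; _∩_)

infixl 6 _⊕_
infix  8 ⊖_
infixl 6 _+ᴱ_
infix  8 -ᴱ_

ℤ^ : ℕ → Set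
ℤ^ d = Vec ℤ d

_⊕_ : ∀ {d} → ℤ^ d → ℤ^ d → ℤ^ d
_⊕_ = zipWith ℤ._+_

⊖_ : ∀ {d} → ℤ^ d → ℤ^ d
⊖_ = map (ℤ.-_)

e : ∀ {d} → Fin d → ℤ^ d
e {d} i = replicate d 0ℤ [ i ]≔ 1ℤ

EdgeSet : ℕ → Set₁
EdgeSet d = Pred (ℤ^ d × ℤ^ d) 0ℓ

𝔼 : ∀ d → EdgeSet d
𝔼 d (u , v) = ∃[ i ] v ≡ u ⊕ e i

-ᴱ_ : ∀ {d} → EdgeSet d → EdgeSet d
(-ᴱ X) p = ∃[ u ] ∃[ v ] (u , v) ∈ X × p ≡ (⊖ v , ⊖ u)

_+ᴱ_ : ∀ {d} → EdgeSet d → ℤ^ d → EdgeSet d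
(X +ᴱ t) p = ∃[ u ] ∃[ v ] (u , v) ∈ X × p ≡ (u ⊕ t , v ⊕ t)

AllPositive : ∀ {d} → Vec ℕ d → Set
AllPositive = All (0 ℕ.<_)

RelativelyPrime : ∀ {d} → Vec ℕ d → Set
RelativelyPrime a = foldr′ gcd 0 a ≡ 1

sum-nonZero : ∀ {d} {a : Vec ℕ d} → 2 ℕ.≤ d → AllPositive a → NonZero (sum a)
sum-nonZero {a = x ∷ a} _ (0<x ∷ _) = >-nonZero (ℕ.≤-trans 0<x (ℕ.m≤m+n x (sum a)))

infix 7 _·_

_·_ : ∀ {d} → Vec ℕ d → ℤ^ d → ℤ
a · x = foldr′ ℤ._+_ 0ℤ (zipWith (λ aᵢ xᵢ → + aᵢ ℤ.* xᵢ) a x)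

-- Fin (sum a), with its usual order, represents ℤ/sℤ; _%ℕ_ always yields the
-- non-negative remainder, also for negative integers.
ℱ : ∀ {d} (a : Vec ℕ d) .{{_ : NonZero (sum a)}} → ℤ^ d → Fin (sum a)
ℱ a x = fromℕ< (n%ℕd<d (a · x) (sum a))

ℋ : ∀ {d} (a : Vec ℕ d) .{{_ : NonZero (sum a)}} → EdgeSet d
ℋ {d} a = 𝔼 d ∩ λ (u , v) → ℱ a u Fin.< ℱ a v

{-# OPTIONS --safe #-}

-- The point reflection w ↦ −(w + t) acts on residues as r ↦ s − 1 − r, because
-- ℱ(t) = 1. It reverses the order of ℤ/sℤ, so it maps every edge (u , v) of ℋ
-- to the edge (−(v + t) , −(u + t)) of ℋ; this gives both inclusions.
module Submission where

open import Defs
open import Data.Nat as ℕ using (ℕ; suc; _≤_; NonZero; s≤s)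
import Data.Nat.Properties as ℕ
import Data.Nat.Divisibility as ℕ
open import Data.Integer as ℤ using (ℤ; +_; 0ℤ; 1ℤ; _+_; _*_; -_)
import Data.Integer.Properties as ℤ
open import Data.Integer.DivMod using (_%ℕ_; _/ℕ_; n%ℕd<d; a≡a%ℕn+[a/ℕn]*n)
open import Data.Integer.Divisibility.Signed using (divides; ∣⇒∣ᵤ)
open import Data.Integer.Tactic.RingSolver using (solve-∀)
open import Data.Fin as Fin using (toℕ)
open import Data.Fin.Properties using (toℕ-fromℕ<)
open import Data.Product using (_,_)
open import Data.Vec using (Vec; []; _∷_; sum)
open import Relation.Binary.PropositionalEquality
open import Relation.Nullary using (contradiction)
open import Relation.Unary using (_≐_; _∈_)

⊖-involutive : ∀ {d} (x : ℤ^ d) → ⊖ ⊖ x ≡ x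
⊖-involutive []      = refl
⊖-involutive (x ∷ v) = cong₂ _∷_ (ℤ.neg-involutive x) (⊖-involutive v)

⊖[x⊕y]⊕y≡⊖x : ∀ {d} (x y : ℤ^ d) → ⊖ (x ⊕ y) ⊕ y ≡ ⊖ x
⊖[x⊕y]⊕y≡⊖x []      []      = refl
⊖[x⊕y]⊕y≡⊖x (x ∷ v) (y ∷ w) = cong₂ _∷_ (identity x y) (⊖[x⊕y]⊕y≡⊖x v w)
  where
  identity : ∀ x y → - (x + y) + y ≡ - x
  identity = solve-∀

-- Used with `y` a basis vector and `z` the translation vector: the reflected edge starts at the
-- image of the old head and keeps its direction, so it lies in `𝔼` again.
⊖[x⊕z]≡⊖[x⊕y⊕z]⊕y : ∀ {d} (x y z : ℤ^ d) → ⊖ (x ⊕ z) ≡ ⊖ (x ⊕ y ⊕ z) ⊕ y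
⊖[x⊕z]≡⊖[x⊕y⊕z]⊕y []      []      []      = refl
⊖[x⊕z]≡⊖[x⊕y⊕z]⊕y (x ∷ u) (y ∷ v) (z ∷ w) =
  cong₂ _∷_ (identity x y z) (⊖[x⊕z]≡⊖[x⊕y⊕z]⊕y u v w)
  where
  identity : ∀ x y z → - (x + z) ≡ - (x + y + z) + y
  identity = solve-∀

·-distribˡ-⊕ : ∀ {d} (a : Vec ℕ d) (x y : ℤ^ d) → a · (x ⊕ y) ≡ a · x + a · y
·-distribˡ-⊕ []      []      []      = refl
·-distribˡ-⊕ (a ∷ b) (x ∷ v) (y ∷ w) =
  trans (cong (λ m → + a * (x + y) + m) (·-distribˡ-⊕ b v w)) (identity (+ a) x y (b · v) (b · w))
  where
  identity : ∀ a x y m n → a * (x + y) + (m + n) ≡ (a * x + m) + (a * y + n)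
  identity = solve-∀

·-⊖ : ∀ {d} (a : Vec ℕ d) (x : ℤ^ d) → a · (⊖ x) ≡ - (a · x)
·-⊖ []      []      = refl
·-⊖ (a ∷ b) (x ∷ v) =
  trans (cong (λ m → + a * (- x) + m) (·-⊖ b v)) (identity (+ a) x (b · v))
  where
  identity : ∀ a x m → a * (- x) + (- m) ≡ - (a * x + m)
  identity = solve-∀

-- A zero quotient would make a successor equal to 0, and a quotient of 2 or more gives at least
-- `s + s`; only the quotient 1 survives.
∣∧<2*⇒≡ : ∀ {n s} → s ℕ.∣ suc n → suc n ℕ.< s ℕ.+ s → suc n ≡ s
∣∧<2*⇒≡ {s = s} (ℕ.divides 1             eq) _  = trans eq (ℕ.*-identityˡ s)
∣∧<2*⇒≡ {s = s} (ℕ.divides (suc (suc k)) eq) lt = contradiction lt (ℕ.≤⇒≯ (begin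
  s ℕ.+ s                 ≤⟨ ℕ.+-monoʳ-≤ s (ℕ.m≤m+n s (k ℕ.* s)) ⟩
  s ℕ.+ (s ℕ.+ k ℕ.* s)   ≡⟨ eq ⟨
  suc _                   ∎))
  where open ℕ.≤-Reasoning

-- The three remainders add up to a multiple of `s`, and the third one is 1. The other two are at
-- most `s - 1` each, so the total stays below `2s`; being positive, it must be `s`.
%ℕ-complement : ∀ (x y z : ℤ) s .{{_ : NonZero s}} →
                x + y + z ≡ 0ℤ → z %ℕ s ≡ 1 → suc (x %ℕ s ℕ.+ y %ℕ s) ≡ s
%ℕ-complement x y z s x+y+z≡0 z%s≡1 = ∣∧<2*⇒≡ (∣⇒∣ᵤ (divides q 1+r≡q*s)) 1+r<2s
  where
  -- Dividing each term of `x + y + z ≡ 0ℤ` with remainder shows that the remainders add up to minus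
  -- the quotients, times `s`.
  q = - (x /ℕ s + y /ℕ s + z /ℕ s)

  1+r<2s : suc (x %ℕ s ℕ.+ y %ℕ s) ℕ.< s ℕ.+ s
  -- Each strict bound on a remainder contributes one `suc`: the first is the 1 in the total, the
  -- second makes the inequality strict.
  1+r<2s = subst (ℕ._≤ s ℕ.+ s) (cong suc (ℕ.+-suc (x %ℕ s) (y %ℕ s)))
             (ℕ.+-mono-≤ (n%ℕd<d x s) (n%ℕd<d y s))

  identity : ∀ a b c i j k s →
             a + b + c ≡ (a + i * s + (b + j * s) + (c + k * s)) + (- (i + j + k)) * s
  identity = solve-∀

  open ≡-Reasoning

  1+r≡q*s : + suc (x %ℕ s ℕ.+ y %ℕ s) ≡ q * + s
  1+r≡q*s = begin
    + suc (x %ℕ s ℕ.+ y %ℕ s)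
      -- The 1 moves to the end, where it is read as the remainder of `z`.
      ≡⟨ cong +_ (ℕ.+-comm 1 (x %ℕ s ℕ.+ y %ℕ s)) ⟩
    + (x %ℕ s) + + (y %ℕ s) + 1ℤ
      ≡⟨ cong (λ r → + (x %ℕ s) + + (y %ℕ s) + + r) z%s≡1 ⟨
    + (x %ℕ s) + + (y %ℕ s) + + (z %ℕ s)
      ≡⟨ identity (+ (x %ℕ s)) (+ (y %ℕ s)) (+ (z %ℕ s)) (x /ℕ s) (y /ℕ s) (z /ℕ s) (+ s) ⟩
    (+ (x %ℕ s) + x /ℕ s * + s + (+ (y %ℕ s) + y /ℕ s * + s) + (+ (z %ℕ s) + z /ℕ s * + s)) + q * + s
      ≡⟨ cong (_+ q * + s) (cong₂ _+_ (cong₂ _+_ (a≡a%ℕn+[a/ℕn]*n x s) (a≡a%ℕn+[a/ℕn]*n y s))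
                                      (a≡a%ℕn+[a/ℕn]*n z s)) ⟨
    x + y + z + q * + s
      ≡⟨ cong (_+ q * + s) x+y+z≡0 ⟩
    0ℤ + q * + s
      ≡⟨ ℤ.+-identityˡ (q * + s) ⟩
    q * + s ∎

module _ {d} (a : Vec ℕ d) .{{_ : NonZero (sum a)}} (t : ℤ^ d) (ℱt≡1 : toℕ (ℱ a t) ≡ 1) where

  toℕ-ℱ : ∀ x → toℕ (ℱ a x) ≡ (a · x) %ℕ sum a
  toℕ-ℱ x = toℕ-fromℕ< (n%ℕd<d (a · x) (sum a))

  -- By linearity the products of `a` with `x`, `⊖ (x ⊕ t)` and `t` cancel, and the last has
  -- remainder 1, so `%ℕ-complement` applies.
  ℱ-reflect : ∀ x → suc (toℕ (ℱ a x) ℕ.+ toℕ (ℱ a (⊖ (x ⊕ t)))) ≡ sum a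
  ℱ-reflect x = trans
    (cong₂ (λ m n → suc (m ℕ.+ n)) (toℕ-ℱ x) (toℕ-ℱ (⊖ (x ⊕ t))))
    (%ℕ-complement (a · x) (a · (⊖ (x ⊕ t))) (a · t) (sum a) sum≡0 (trans (sym (toℕ-ℱ t)) ℱt≡1))
    where
    identity : ∀ m n → m + (- (m + n)) + n ≡ 0ℤ
    identity = solve-∀

    sum≡0 : a · x + a · (⊖ (x ⊕ t)) + a · t ≡ 0ℤ
    sum≡0 = trans
      (cong (λ m → a · x + m + a · t) (trans (·-⊖ a (x ⊕ t)) (cong -_ (·-distribˡ-⊕ a x t))))
      (identity (a · x) (a · t))

  ℱ-reflect-< : ∀ u v → ℱ a u Fin.< ℱ a v → ℱ a (⊖ (v ⊕ t)) Fin.< ℱ a (⊖ (u ⊕ t))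
  -- Otherwise the sum in `ℱ-reflect` would be strictly smaller at `u` than at `v`, although both
  -- equal `sum a`.
  ℱ-reflect-< u v ℱu<ℱv = ℕ.≰⇒> λ ℱu′≤ℱv′ →
    ℕ.<⇒≢ (s≤s (ℕ.+-mono-<-≤ ℱu<ℱv ℱu′≤ℱv′)) (trans (ℱ-reflect u) (sym (ℱ-reflect v)))

  ℋ-reflect : ∀ {u v} → (u , v) ∈ ℋ a → (⊖ (v ⊕ t) , ⊖ (u ⊕ t)) ∈ ℋ a
  ℋ-reflect {u} ((i , refl) , ℱu<ℱv) =
    (i , ⊖[x⊕z]≡⊖[x⊕y⊕z]⊕y u (e i) t) , ℱ-reflect-< u (u ⊕ e i) ℱu<ℱv

  -ℋ≐ℋ+t : (-ᴱ ℋ a) ≐ (ℋ a +ᴱ t)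
  -ℋ≐ℋ+t =
    -- Translating the reflected edge by `t` cancels the shift and leaves `(⊖ v , ⊖ u)`.
    (λ { (u , v , uv∈ℋ , refl) → ⊖ (v ⊕ t) , ⊖ (u ⊕ t) , ℋ-reflect uv∈ℋ ,
           sym (cong₂ _,_ (⊖[x⊕y]⊕y≡⊖x v t) (⊖[x⊕y]⊕y≡⊖x u t)) }) ,
    -- The witness is the same edge; reversing it negates a second time and leaves
    -- `(u ⊕ t , v ⊕ t)`.
    (λ { (u , v , uv∈ℋ , refl) → ⊖ (v ⊕ t) , ⊖ (u ⊕ t) , ℋ-reflect uv∈ℋ ,
           sym (cong₂ _,_ (⊖-involutive (u ⊕ t)) (⊖-involutive (v ⊕ t))) })

corollary25 : ∀ d (2≤d : 2 ≤ d) (a : Vec ℕ d) (a>0 : AllPositive a) →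
    RelativelyPrime a → (t : ℤ^ d) →
    let instance s≢0 = sum-nonZero 2≤d a>0 in
    toℕ (ℱ a t) ≡ 1 → (-ᴱ ℋ a) ≐ (ℋ a +ᴱ t)
corollary25 d 2≤d a a>0 _ t = -ℋ≐ℋ+t a {{sum-nonZero 2≤d a>0}} t
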